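{- Let $A=\{1\text{ - }32\text{ - }4,\ 1\text{ - }42\text{ - }3,\ 2\text{ - }31\text{ - }4,\ 2\text{ - }41\text{ - }3\}$ and $B=\{1\text{ - }3\text{ - }2\text{ - }4,\ 1\text{ - }4\text{ - }2\text{ - }3,\ 2\text{ - }3\text{ - }1\text{ - }4,\ 2\text{ - }4\text{ - }1\text{ - }3\}$ be sets of (dashed) patterns. For $n\ge 1$ let $a_n=|\mathrm{Av}_n(B)|$ be the number of permutations of length $n$ avoiding all patterns in $B$. Then $a_1=1$, $a_2=2$, and $a_n=4a_{n-1}-2a_{n-2}$ for all $n\ge 3$. The same holds with $A$ in place of $B$: the numbers $|\mathrm{Av}_n(A)|$ satisfy $|\mathrm{Av}_1(A)|=1$, $|\mathrm{Av}_2(A)|=2$, and $|\mathrm{Av}_n(A)|=4|\mathrm{Av}_{n-1}(A)|-2|\mathrm{Av}_{n-2}(A)|$ for all $n\ge 3$.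
   Context: A permutation of length $n$ is written in one-line notation $\sigma_1\sigma_2\cdots\sigma_n$, a rearrangement of $1,\dots,n$. A (dashed, generalized) pattern is a permutation $\pi_1\cdots\pi_k$ in which some or all of the adjacent elements may be separated by dashes. A subsequence $\sigma_{i_1}\sigma_{i_2}\cdots\sigma_{i_k}$ (with $i_1<i_2<\cdots<i_k$) of a permutation $\sigma$ is an occurrence of the pattern if (i) its elements have the same relative order as $\pi_1,\dots,\pi_k$ (i.e. $\sigma_{i_s}<\sigma_{i_t}$ if and only if $\pi_s<\pi_t$), and (ii) whenever there is no dash between the $j$th and $(j+1)$th elements of the pattern, the $j$th and $(j+1)$th elements of the subsequence occur consecutively in $\sigma$ (i.e. $i_{j+1}=i_j+1$). Where there is a dash, the corresponding elements may or may not be consecutive in $\sigma$. A permutation avoids a pattern if it contains no occurrence of it, and avoids a set of patterns if it contains no occurrence of any pattern in the set. For a set $S$ of patterns, $\mathrm{Av}_n(S)$ denotes the set of all permutations of length $n$ that avoid $S$. -}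

module Defs where

open import Data.Fin.Base using (Fin; zero; suc; toℕ; inject₁; _<_; combine; remQuot; punchIn)
open import Data.Fin.Patterns using (0F; 1F; 2F; 3F)
open import Data.Fin.Permutation
  using (Permutation′; id; permutation; _⟨$⟩ʳ_; insert; remove; insert-remove)
  renaming (_≈_ to _≈ₚ_)
open import Data.Fin.Properties
  using (_≟_; _<?_; all?; any?; suc-injective; remQuot-combine; combine-remQuot; punchIn-injective)
open import Data.List.Base using (List; []; _∷_)
open import Data.List.Relation.Unary.All as All using (All)
open import Data.Nat.Base using (ℕ; zero; suc; _*_)
import Data.Nat.Properties as ℕ
open import Data.Product.Base using (Σ-syntax; ∃; ∃-syntax; _×_; _,_; proj₁; proj₂; uncurry)
open import Data.Vec.Base using (Vec; []; _∷_; lookup)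
open import Function.Base using (_∘_)
open import Function.Bundles using (Bijection; Equivalence; _⇔_; mk⇔)
open import Function.Definitions using (Injective)
open import Level using (0ℓ)
open import Relation.Binary.Bundles using (Setoid)
import Relation.Binary.Construct.On as On
open import Relation.Binary.PropositionalEquality
  using (_≡_; refl; sym; trans; cong; subst₂; setoid)
open import Relation.Nullary using (¬_; Dec; yes; no; contradiction)
open import Relation.Nullary.Decidable using (True; toWitness; map′; _×-dec_; _→-dec_; ¬?)
open import Relation.Unary using (Pred; Decidable)

data Gap : Set where
  dash adjacent : Gap

-- The j-th gap separates the letters in positions j and j + 1.
record Pattern : Set where
  constructor _separatedBy_
  field
    {gapCount} : ℕ
    letters    : Permutation′ (suc gapCount)
    gaps       : Vec Gap gapCount

-- i is the vector of positions i₁ < i₂ < ⋯ < iₖ, not of values.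
record IsOccurrence {n} (p : Pattern) (σ : Permutation′ n)
                    (i : Vec (Fin n) (suc (Pattern.gapCount p))) : Set where
  open Pattern p
  field
    increasing : ∀ s t → s < t → lookup i s < lookup i t
    sameOrder  : ∀ s t → (σ ⟨$⟩ʳ lookup i s < σ ⟨$⟩ʳ lookup i t)
                         ⇔ (letters ⟨$⟩ʳ s < letters ⟨$⟩ʳ t)
    contiguous : ∀ j → lookup gaps j ≡ adjacent →
                 toℕ (lookup i (suc j)) ≡ suc (toℕ (lookup i (inject₁ j)))

Contains : ∀ {n} → Permutation′ n → Pattern → Set
Contains σ p = ∃[ i ] IsOccurrence p σ i

Avoids : ∀ {n} → Permutation′ n → List Pattern → Set
Avoids σ S = All (λ p → ¬ Contains σ p) S

-- Equality in both setoids is pointwise equality of the underlying maps, so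
-- that permutations are counted rather than proofs about them.
Perm : ℕ → Setoid 0ℓ 0ℓ
Perm n = record
  { Carrier       = Permutation′ n
  ; _≈_           = _≈ₚ_
  ; isEquivalence = record
    { refl  = λ _ → refl
    ; sym   = λ e i → sym (e i)
    ; trans = λ e f i → trans (e i) (f i)
    }
  }

Av : ℕ → List Pattern → Setoid 0ℓ 0ℓ
Av n S = record
  { Carrier       = Σ[ σ ∈ Permutation′ n ] Avoids σ S
  ; _≈_           = λ x y → proj₁ x ≈ₚ proj₁ y
  ; isEquivalence = On.isEquivalence proj₁ (Setoid.isEquivalence (Perm n))
  }

record Finite (X : Setoid 0ℓ 0ℓ) : Set where
  field
    size        : ℕ
    enumeration : Bijection (setoid (Fin size)) X

perm-finite : ∀ n → Finite (Perm n)
perm-finite zero = record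
  { size        = 1
  ; enumeration = record
    { to        = λ _ → id
    ; cong      = λ _ ()
    ; bijective = (λ { {zero} {zero} _ → refl }) , λ _ → zero , λ _ ()
    }
  }
perm-finite (suc n) = record
  { size        = suc n * size
  ; enumeration = record
    { to        = to′
    ; cong      = λ { refl _ → refl }
    ; bijective = inj , surj
    }
  }
  where
  open Finite (perm-finite n)
  open Bijection enumeration using (to; injective; strictlySurjective)

  ins : Fin (suc n) × Fin size → Permutation′ (suc n)
  ins (j , r) = insert 0F j (to r)

  to′ : Fin (suc n * size) → Permutation′ (suc n)
  to′ = ins ∘ remQuot size

  ins-injective : ∀ x y → ins x ≈ₚ ins y → x ≡ y
  ins-injective (j , r) (j′ , r′) e with refl ← e 0F =
    cong (j ,_) (injective λ k → punchIn-injective j _ _ (e (suc k)))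

  inj : Injective _≡_ _≈ₚ_ to′
  inj {x} {y} e = trans (sym (combine-remQuot {suc n} size x))
    (trans (cong (uncurry combine) (ins-injective (remQuot size x) (remQuot size y) e))
           (combine-remQuot {suc n} size y))

  insert-cong : ∀ j (π ρ : Permutation′ n) → π ≈ₚ ρ → insert 0F j π ≈ₚ insert 0F j ρ
  insert-cong j π ρ e zero    = refl
  insert-cong j π ρ e (suc k) = cong (punchIn j) (e k)

  surj : ∀ π → ∃[ x ] (∀ {z} → z ≡ x → to′ z ≈ₚ π)
  surj π = combine j r , λ { refl k → trans
      (cong (λ x → ins x ⟨$⟩ʳ k) (remQuot-combine j r))
      (trans (insert-cong j (to r) ρ (proj₂ pre) k) (insert-remove 0F π k)) }
    where
    j = π ⟨$⟩ʳ 0F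
    ρ = remove 0F π
    pre = strictlySurjective ρ
    r = proj₁ pre

private
  record Sub {m} (P : Pred (Fin m) 0ℓ) : Set where
    field
      count     : ℕ
      embed     : Fin count → Fin m
      injective : Injective _≡_ _≡_ embed
      sound     : ∀ i → P (embed i)
      complete  : ∀ j → P j → ∃[ i ] embed i ≡ j

  sub : ∀ m (P : Pred (Fin m) 0ℓ) → Decidable P → Sub P
  sub zero    P P? = record
    { count = 0 ; embed = λ () ; injective = λ { {()} } ; sound = λ () ; complete = λ () }
  sub (suc m) P P? with sub m (P ∘ suc) (P? ∘ suc) | P? zero
  ... | s | no ¬p = record
    { count     = count
    ; embed     = suc ∘ embed
    ; injective = injective ∘ suc-injective
    ; sound     = sound
    ; complete  = λ { zero p → contradiction p ¬p
                    ; (suc j) p → proj₁ (complete j p) , cong suc (proj₂ (complete j p)) }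
    }
    where open Sub s
  ... | s | yes p₀ = record
    { count     = suc count
    ; embed     = λ { zero → zero ; (suc i) → suc (embed i) }
    ; injective = λ { {zero} {zero} _ → refl
                    ; {suc _} {suc _} e → cong suc (injective (suc-injective e)) }
    ; sound     = λ { zero → p₀ ; (suc i) → sound i }
    ; complete  = λ { zero p → zero , refl
                    ; (suc j) p → suc (proj₁ (complete j p)) , cong suc (proj₂ (complete j p)) }
    }
    where open Sub s

  anyVec? : ∀ {n} k {P : Pred (Vec (Fin n) k) 0ℓ} → Decidable P → Dec (∃ P)
  anyVec? zero    P? = map′ (λ p → [] , p) (λ { ([] , p) → p }) (P? [])
  anyVec? (suc k) P? = map′
    (λ { (x , xs , p) → x ∷ xs , p })
    (λ { (x ∷ xs , p) → x , xs , p })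
    (any? λ x → anyVec? k λ xs → P? (x ∷ xs))

  adjacent? : ∀ g → Dec (g ≡ adjacent)
  adjacent? dash     = no λ ()
  adjacent? adjacent = yes refl

isOccurrence? : ∀ {n} (p : Pattern) (σ : Permutation′ n) → Decidable (IsOccurrence p σ)
isOccurrence? p σ i = map′
  (λ (a , b , c) → record
    { increasing = a
    ; sameOrder  = λ s t → mk⇔ (proj₁ (b s t)) (proj₂ (b s t))
    ; contiguous = c
    })
  (λ o → let open IsOccurrence o in
    increasing , (λ s t → Equivalence.to (sameOrder s t) , Equivalence.from (sameOrder s t)) , contiguous)
  (all? (λ s → all? λ t → (s <? t) →-dec (lookup i s <? lookup i t))
   ×-dec all? (λ s → all? λ t →
     let σ<? = (σ ⟨$⟩ʳ lookup i s) <? (σ ⟨$⟩ʳ lookup i t)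
         π<? = (letters ⟨$⟩ʳ s) <? (letters ⟨$⟩ʳ t)
     in (σ<? →-dec π<?) ×-dec (π<? →-dec σ<?))
   ×-dec all? (λ j → adjacent? (lookup gaps j)
     →-dec (toℕ (lookup i (suc j)) ℕ.≟ suc (toℕ (lookup i (inject₁ j))))))
  where open Pattern p

avoids? : ∀ {n} (S : List Pattern) (σ : Permutation′ n) → Dec (Avoids σ S)
avoids? S σ = All.all? (λ p → ¬? (anyVec? _ (isOccurrence? p σ))) S

isOccurrence-resp : ∀ {n p i} {σ τ : Permutation′ n} → σ ≈ₚ τ →
                    IsOccurrence p σ i → IsOccurrence p τ i
isOccurrence-resp {i = i} e o = record
  { increasing = increasing
  ; sameOrder  = λ s t → mk⇔
      (Equivalence.to (sameOrder s t) ∘ subst₂ _<_ (sym (e (lookup i s))) (sym (e (lookup i t))))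
      (subst₂ _<_ (e (lookup i s)) (e (lookup i t)) ∘ Equivalence.from (sameOrder s t))
  ; contiguous = contiguous
  }
  where open IsOccurrence o

avoids-resp : ∀ {n S} {σ τ : Permutation′ n} → σ ≈ₚ τ → Avoids σ S → Avoids τ S
avoids-resp e = All.map λ { ¬c (i , o) → ¬c (i , isOccurrence-resp (sym ∘ e) o) }

av-finite : ∀ n S → Finite (Av n S)
av-finite n S = record
  { size        = count
  ; enumeration = record
    { to        = λ i → to (embed i) , sound i
    ; cong      = λ { refl _ → refl }
    ; bijective = (λ e → Sub.injective s (injective e)) , surj
    }
  }
  where
  open Finite (perm-finite n)
  open Bijection enumeration using (to; injective; strictlySurjective)
  s = sub size (λ i → Avoids (to i) S) (λ i → avoids? S (to i))
  open Sub s using (count; embed; sound; complete)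

  surj : ∀ y → ∃[ x ] (∀ {z} → z ≡ x → to (embed z) ≈ₚ proj₁ y)
  surj (σ , av) with r , e ← strictlySurjective σ
    with i , refl ← complete r (avoids-resp (sym ∘ e) av) = i , λ { refl → e }

∣Av∣ : ℕ → List Pattern → ℕ
∣Av∣ n S = Finite.size (av-finite n S)

-- The permutation with one-line notation v; the second word must be its
-- inverse, which is checked by evaluation.
oneLine : ∀ {n} (v w : Vec (Fin n) n) →
          {True (all? λ i → lookup v (lookup w i) ≟ i)} →
          {True (all? λ i → lookup w (lookup v i) ≟ i)} → Permutation′ n
oneLine v w {vw} {wv} = permutation (lookup v) (lookup w) (toWitness vw) (toWitness wv)

-- Letters are numbered from 0 here, so 1324 becomes 0 2 1 3.
⟨1324⟩ ⟨1423⟩ ⟨2314⟩ ⟨2413⟩ : Permutation′ 4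
⟨1324⟩ = oneLine (0F ∷ 2F ∷ 1F ∷ 3F ∷ []) (0F ∷ 2F ∷ 1F ∷ 3F ∷ [])
⟨1423⟩ = oneLine (0F ∷ 3F ∷ 1F ∷ 2F ∷ []) (0F ∷ 2F ∷ 3F ∷ 1F ∷ [])
⟨2314⟩ = oneLine (1F ∷ 2F ∷ 0F ∷ 3F ∷ []) (2F ∷ 0F ∷ 1F ∷ 3F ∷ [])
⟨2413⟩ = oneLine (1F ∷ 3F ∷ 0F ∷ 2F ∷ []) (2F ∷ 0F ∷ 3F ∷ 1F ∷ [])

x-xx-x x-x-x-x : Vec Gap 3
x-xx-x  = dash ∷ adjacent ∷ dash ∷ []
x-x-x-x = dash ∷ dash ∷ dash ∷ []

A B : List Pattern
A = (⟨1324⟩ separatedBy x-xx-x)  ∷ (⟨1423⟩ separatedBy x-xx-x)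
  ∷ (⟨2314⟩ separatedBy x-xx-x)  ∷ (⟨2413⟩ separatedBy x-xx-x)  ∷ []
B = (⟨1324⟩ separatedBy x-x-x-x) ∷ (⟨1423⟩ separatedBy x-x-x-x)
  ∷ (⟨2314⟩ separatedBy x-x-x-x) ∷ (⟨2413⟩ separatedBy x-x-x-x) ∷ []

{-# OPTIONS --safe #-}

-- In all four patterns the first and third letters are smaller than the second
-- and fourth, so avoiding B means that no "crossing" a < b < c < d with
-- σ a, σ c < σ b, σ d exists.  Walking from b towards c one finds a crossing
-- with adjacent b and c, so A and B are avoided by the same permutations.
--
-- Build a permutation by inserting values in increasing order.  A new maximum
-- may always go to the front.  Otherwise it goes at a position i ≥ 1, and with
-- j the position of the previous maximum, no crossing arises only if j = 0,
-- i = j + 1 or i = j.  In each case the previous maximum is redundant: it can be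
-- deleted without affecting crossings, leaving a permutation whose maximum is
-- again not in front, except that j = 0, i = 1 leaves two free leading letters
-- before an arbitrary permutation.  With s n permutations in all, and w n
-- permutations of length n + 1 whose maximum is not in front, this gives
-- s (n + 1) = s n + w n and w (n + 1) = s n + 3 w n, hence the recurrence.
module Submission where

open import Defs
open import Data.Empty using (⊥)
open import Data.Fin.Base
  using (Fin; zero; suc; toℕ; fromℕ; fromℕ<; inject₁; punchIn; pinch; _<_)
open import Data.Fin.Patterns using (0F; 1F; 2F; 3F)
open import Data.Fin.Permutation
  using (Permutation′; id; _⟨$⟩ʳ_; _⟨$⟩ˡ_; inverseˡ; inverseʳ; insert; remove;
         insert-punchIn; insert-remove; ↔⇒≡)
  renaming (_≈_ to _≈ₚ_)
open import Data.Fin.Properties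
  using (_≟_; _<?_; <-cmp; ≤∧≢⇒<; ≤fromℕ; toℕ<n; toℕ-fromℕ<; toℕ-inject₁;
         inject₁-injective; suc-injective; punchIn-injective; punchIn-mono-≤; punchIn-cancel-≤;
         punchInᵢ≢i; punchIn-punchOut; pinch-mono-≤; +↔⊎; *↔×)
open import Data.Integer.Base using (+_; _+_; _*_; _-_)
import Data.Integer.Properties as ℤ
open import Data.Integer.Tactic.RingSolver using (solve-∀)
open import Data.List.Base using (List; []; _∷_)
open import Data.List.Relation.Unary.All using ([]; _∷_)
open import Data.Nat.Base as ℕ using (ℕ; zero; suc; _≥_; _∸_; z<s; s<s)
import Data.Nat.Properties as ℕ
open import Data.Product.Base using (∃-syntax; _×_; _,_; proj₁; proj₂)
open import Data.Product.Function.NonDependent.Propositional using (_×-cong_)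
open import Data.Sum.Base using (_⊎_; inj₁; inj₂)
open import Data.Sum.Function.Propositional using (_⊎-cong_)
open import Data.Vec.Base using (Vec; []; _∷_; lookup)
open import Function.Base using (_∘_)
open import Function.Bundles using (Bijection; Equivalence; Injection; mk⇔; _↔_; mk↔ₛ′)
import Function.Construct.Composition as Composition
open Composition using (_↔-∘_)
open import Function.Construct.Identity using (↔-id)
import Function.Construct.Symmetry as Symmetry
open Symmetry using (↔-sym)
open import Function.Properties.Bijection using (Bijection⇒Inverse)
open import Function.Properties.Inverse using (↔⇒↣)
open import Relation.Binary.Definitions using (Tri; tri<; tri≈; tri>)
open import Relation.Binary.PropositionalEquality
open import Relation.Nullary using (¬_; Dec; yes; no; contradiction)

private
  variable
    m n : ℕ

-- Order facts about skipping a position.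

⟨$⟩ʳ-injective : (σ : Permutation′ n) {x y : Fin n} → σ ⟨$⟩ʳ x ≡ σ ⟨$⟩ʳ y → x ≡ y
⟨$⟩ʳ-injective σ = Injection.injective (↔⇒↣ σ)

<⇒≢ : {x y : Fin n} → x < y → x ≢ y
<⇒≢ x<y refl = ℕ.<-irrefl refl x<y

punchIn-mono-< : ∀ i {x y : Fin n} → x < y → punchIn i x < punchIn i y
punchIn-mono-< i x<y = ℕ.≰⇒> (ℕ.<⇒≱ x<y ∘ punchIn-cancel-≤ i _ _)

punchIn-cancel-< : ∀ i {x y : Fin n} → punchIn i x < punchIn i y → x < y
punchIn-cancel-< i lt = ℕ.≰⇒> (ℕ.<⇒≱ lt ∘ punchIn-mono-≤ i _ _)

data PunchView (i : Fin (suc n)) : Fin (suc n) → Set where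
  punched : PunchView i i
  kept    : ∀ x → PunchView i (punchIn i x)

punchView : ∀ (i x : Fin (suc n)) → PunchView i x
punchView i x with i ≟ x
... | yes refl = punched
... | no  i≢x  = subst (PunchView i) (punchIn-punchOut i≢x) (kept _)

-- Inserting a new maximum.

-- Opaque, so that implicit positions can be inferred from insertMax i π ⟨$⟩ʳ x.
opaque
  insertMax : Fin (suc n) → Permutation′ n → Permutation′ (suc n)
  insertMax i = insert i (fromℕ _)

  insertMax-punched : ∀ i (π : Permutation′ n) → insertMax i π ⟨$⟩ʳ i ≡ fromℕ n
  insertMax-punched i π with i ≟ i
  ... | yes _   = refl
  ... | no  i≢i = contradiction refl i≢i

  insertMax-kept : ∀ i (π : Permutation′ n) x →
                   insertMax i π ⟨$⟩ʳ punchIn i x ≡ punchIn (fromℕ n) (π ⟨$⟩ʳ x)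
  insertMax-kept i = insert-punchIn i (fromℕ _)

  insertMax-surjective : ∀ (σ : Permutation′ (suc n)) → ∃[ i ] ∃[ π ] insertMax i π ≈ₚ σ
  insertMax-surjective {n} σ = i , remove i σ ,
    subst (λ v → insert i v (remove i σ) ≈ₚ σ) (inverseʳ σ) (insert-remove i σ)
    where
    i : Fin (suc n)
    i = σ ⟨$⟩ˡ fromℕ n

module _ (i : Fin (suc n)) (π : Permutation′ n) where
  private
    σ = insertMax i π

  insertMax-mono : ∀ {x y} → π ⟨$⟩ʳ x < π ⟨$⟩ʳ y → σ ⟨$⟩ʳ punchIn i x < σ ⟨$⟩ʳ punchIn i y
  insertMax-mono {x} {y} lt rewrite insertMax-kept i π x | insertMax-kept i π y =
    punchIn-mono-< (fromℕ n) lt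

  insertMax-cancel : ∀ {x y} → σ ⟨$⟩ʳ punchIn i x < σ ⟨$⟩ʳ punchIn i y → π ⟨$⟩ʳ x < π ⟨$⟩ʳ y
  insertMax-cancel {x} {y} lt rewrite insertMax-kept i π x | insertMax-kept i π y =
    punchIn-cancel-< (fromℕ n) lt

  insertMax-≮ : ∀ {x} → ¬ σ ⟨$⟩ʳ i < σ ⟨$⟩ʳ x
  insertMax-≮ {x} lt rewrite insertMax-punched i π = ℕ.<⇒≱ lt (≤fromℕ (σ ⟨$⟩ʳ x))

  insertMax-> : ∀ {x} → x ≢ i → σ ⟨$⟩ʳ x < σ ⟨$⟩ʳ i
  insertMax-> {x} x≢i with punchView i x
  ... | punched = contradiction refl x≢i
  ... | kept y rewrite insertMax-punched i π | insertMax-kept i π y =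
    ≤∧≢⇒< (≤fromℕ _) (punchInᵢ≢i (fromℕ n) _)

insertMax-cong : ∀ i {π ρ : Permutation′ n} → π ≈ₚ ρ → insertMax i π ≈ₚ insertMax i ρ
insertMax-cong i {π} {ρ} π≈ρ x with punchView i x
... | punched = trans (insertMax-punched i π) (sym (insertMax-punched i ρ))
... | kept y  = trans (insertMax-kept i π y)
                  (trans (cong (punchIn _) (π≈ρ y)) (sym (insertMax-kept i ρ y)))

insertMax-injective : ∀ {i j} {π ρ : Permutation′ n} →
                      insertMax i π ≈ₚ insertMax j ρ → i ≡ j × π ≈ₚ ρ
insertMax-injective {i = i} {j} {π} {ρ} eq with punchView j i
... | punched = refl , λ x → punchIn-injective (fromℕ _) _ _
  (trans (sym (insertMax-kept i π x)) (trans (eq (punchIn i x)) (insertMax-kept i ρ x)))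
... | kept y = contradiction
  (trans (sym (insertMax-kept j ρ y)) (trans (sym (eq i)) (insertMax-punched i π)))
  (punchInᵢ≢i (fromℕ _) _)

-- Crossings under insertion and deletion of letters.

-- The order of `σ a` and `σ c` and that of `σ b` and `σ d` stay open: the four choices are the four
-- patterns.
record Crossing (σ : Permutation′ n) : Set where
  field
    {a b c d} : Fin n
    a<b   : a < b
    b<c   : b < c
    c<d   : c < d
    σa<σb : σ ⟨$⟩ʳ a < σ ⟨$⟩ʳ b
    σa<σd : σ ⟨$⟩ʳ a < σ ⟨$⟩ʳ d
    σc<σb : σ ⟨$⟩ʳ c < σ ⟨$⟩ʳ b
    σc<σd : σ ⟨$⟩ʳ c < σ ⟨$⟩ʳ d

  b≢d : b ≢ d
  b≢d = <⇒≢ (ℕ.<-trans b<c c<d)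

crossing-map : {σ : Permutation′ m} {τ : Permutation′ n} (f : Fin m → Fin n) →
               (∀ {x y} → x < y → f x < f y) →
               (∀ {x y} → σ ⟨$⟩ʳ x < σ ⟨$⟩ʳ y → τ ⟨$⟩ʳ f x < τ ⟨$⟩ʳ f y) →
               Crossing σ → Crossing τ
crossing-map f mono mono-val X = record
  { a<b   = mono a<b
  ; b<c   = mono b<c
  ; c<d   = mono c<d
  ; σa<σb = mono-val σa<σb
  ; σa<σd = mono-val σa<σd
  ; σc<σb = mono-val σc<σb
  ; σc<σd = mono-val σc<σd
  }
  where open Crossing X

crossing-resp : {σ τ : Permutation′ n} → σ ≈ₚ τ → Crossing σ → Crossing τ
crossing-resp eq = crossing-map (λ x → x) (λ lt → lt) (subst₂ _<_ (eq _) (eq _))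

crossing-insertMax : ∀ i (π : Permutation′ n) → Crossing π → Crossing (insertMax i π)
crossing-insertMax i π = crossing-map (punchIn i) (punchIn-mono-< i) (insertMax-mono i π)

-- The front letter can only play the role of `a`, which needs two distinct larger letters, at `b`
-- and `d`. With at most one larger letter it lies in no crossing, so all four positions are
-- successors.
crossing-dropFront : {σ : Permutation′ (suc n)} {τ : Permutation′ n} →
  (∀ {x y} → σ ⟨$⟩ʳ 0F < σ ⟨$⟩ʳ x → σ ⟨$⟩ʳ 0F < σ ⟨$⟩ʳ y → x ≡ y) →
  (∀ {x y} → σ ⟨$⟩ʳ suc x < σ ⟨$⟩ʳ suc y → τ ⟨$⟩ʳ x < τ ⟨$⟩ʳ y) →
  Crossing σ → Crossing τ
crossing-dropFront unique cancel X@record { a = zero } =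
  contradiction (unique σa<σb σa<σd) b≢d
  where open Crossing X
crossing-dropFront unique cancel
  record { a = suc _ ; b = suc _ ; c = suc _ ; d = suc _
         ; a<b = s<s a<b ; b<c = s<s b<c ; c<d = s<s c<d
         ; σa<σb = ab ; σa<σd = ad ; σc<σb = cb ; σc<σd = cd } = record
  { a<b   = a<b
  ; b<c   = b<c
  ; c<d   = c<d
  ; σa<σb = cancel ab
  ; σa<σd = cancel ad
  ; σc<σb = cancel cb
  ; σc<σd = cancel cd
  }

crossing-maxFront : ∀ (π : Permutation′ n) → Crossing (insertMax 0F π) → Crossing π
crossing-maxFront π = crossing-dropFront {τ = π}
  (λ lt _ → contradiction lt (insertMax-≮ 0F π)) (insertMax-cancel 0F π)

module _ (i : Fin (suc n)) (ρ : Permutation′ n) where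
  private
    σ = insertMax (suc i) (insertMax 0F ρ)
    τ = insertMax i ρ

  -- Deleting the leading letter of `σ`, the previous maximum, leaves `τ` up to relative order; this
  -- and `front-mono` are the two directions.
  front-cancel : ∀ {x y} → σ ⟨$⟩ʳ suc x < σ ⟨$⟩ʳ suc y → τ ⟨$⟩ʳ x < τ ⟨$⟩ʳ y
  front-cancel {x} {y} lt with punchView i x | punchView i y
  ... | punched | _       = contradiction lt (insertMax-≮ (suc i) (insertMax 0F ρ))
  ... | kept x′ | punched = insertMax-> i ρ (punchInᵢ≢i i x′)
  -- `punchIn (suc i) (suc x′)` reduces to `suc (punchIn i x′)`, and `suc x′` is `punchIn 0F x′`, so
  -- both insertions can be undone.
  ... | kept x′ | kept y′ = insertMax-mono i ρ
    (insertMax-cancel 0F ρ (insertMax-cancel (suc i) (insertMax 0F ρ) {suc x′} {suc y′} lt))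

  front-mono : ∀ {x y} → τ ⟨$⟩ʳ x < τ ⟨$⟩ʳ y → σ ⟨$⟩ʳ suc x < σ ⟨$⟩ʳ suc y
  front-mono {x} {y} lt with punchView i x | punchView i y
  ... | punched | _       = contradiction lt (insertMax-≮ i ρ)
  ... | kept x′ | punched = insertMax-> (suc i) (insertMax 0F ρ) (punchInᵢ≢i (suc i) (suc x′))
  ... | kept x′ | kept y′ = insertMax-mono (suc i) (insertMax 0F ρ) {suc x′} {suc y′}
    (insertMax-mono 0F ρ (insertMax-cancel i ρ lt))

  front-unique : ∀ {x} → σ ⟨$⟩ʳ 0F < σ ⟨$⟩ʳ x → x ≡ suc i
  front-unique {x} lt with punchView (suc i) x
  ... | punched = refl
  ... | kept x′ = contradiction
    (insertMax-cancel (suc i) (insertMax 0F ρ) {0F} {x′} lt) (insertMax-≮ 0F ρ)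

  crossing-frontSecond : Crossing σ → Crossing τ
  crossing-frontSecond = crossing-dropFront {τ = τ}
    (λ p q → trans (front-unique p) (sym (front-unique q))) front-cancel

  crossing-frontSecond⁻ : Crossing τ → Crossing σ
  crossing-frontSecond⁻ = crossing-map suc s<s front-mono

-- Merging a new maximum with an adjacent previous maximum.

-- The letter at i and the maximum of π at j are adjacent, and pinch j merges them.
module _ (π : Permutation′ n) {j : Fin n} {i : Fin (suc n)}
         (max : ∀ {x} → x ≢ j → π ⟨$⟩ʳ x < π ⟨$⟩ʳ j)
         (pinch-punched : pinch j i ≡ j)
         (pinch-kept : ∀ x → pinch j (punchIn i x) ≡ x) where
  private
    σ = insertMax i π

  -- Merging can only spoil the comparison between the two top letters, and `x` is neither of them.
  pinch-val : ∀ {x y} → pinch j x ≢ j → σ ⟨$⟩ʳ x < σ ⟨$⟩ʳ y →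
              π ⟨$⟩ʳ pinch j x < π ⟨$⟩ʳ pinch j y
  pinch-val {x} {y} x≢j lt with punchView i x | punchView i y
  ... | punched | _       = contradiction lt (insertMax-≮ i π)
  ... | kept x′ | punched rewrite pinch-punched = max x≢j
  ... | kept x′ | kept y′ rewrite pinch-kept x′ | pinch-kept y′ = insertMax-cancel i π lt

  pinch-< : ∀ {x y} → pinch j x ≢ j ⊎ pinch j y ≢ j → x < y → pinch j x < pinch j y
  pinch-< {x} {y} ≢j x<y = ≤∧≢⇒< (pinch-mono-≤ j (ℕ.<⇒≤ x<y)) (distinct ≢j)
    where
    distinct : pinch j x ≢ j ⊎ pinch j y ≢ j → pinch j x ≢ pinch j y
    distinct ≢j eq with punchView i x | punchView i y
    distinct (inj₁ x≢j) eq | punched | _       = x≢j pinch-punched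
    distinct (inj₂ y≢j) eq | punched | _       = y≢j (trans (sym eq) pinch-punched)
    distinct (inj₁ x≢j) eq | kept x′ | punched = x≢j (trans eq pinch-punched)
    distinct (inj₂ y≢j) eq | kept x′ | punched = y≢j pinch-punched
    distinct _          eq | kept x′ | kept y′ rewrite pinch-kept x′ | pinch-kept y′ | eq =
      <⇒≢ x<y refl

  kept<kept⇒≢ : ∀ {x y} → σ ⟨$⟩ʳ punchIn i x < σ ⟨$⟩ʳ punchIn i y → x ≢ j
  kept<kept⇒≢ {y = y} lt refl with y ≟ j
  ... | yes refl = ℕ.<-irrefl refl lt
  ... | no  y≢j  = ℕ.<-asym (insertMax-cancel i π lt) (max y≢j)

  -- A letter below two distinct letters is neither the maximum nor the second maximum, and these
  -- are the only two merged into `j`.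
  low⇒pinch≢ : ∀ {x y z} → y ≢ z → σ ⟨$⟩ʳ x < σ ⟨$⟩ʳ y → σ ⟨$⟩ʳ x < σ ⟨$⟩ʳ z → pinch j x ≢ j
  low⇒pinch≢ {x} {y} {z} y≢z xy xz with punchView i x | punchView i y | punchView i z
  ... | punched | _       | _       = contradiction xy (insertMax-≮ i π)
  ... | kept x′ | punched | punched = contradiction refl y≢z
  ... | kept x′ | kept _  | _       rewrite pinch-kept x′ = kept<kept⇒≢ xy
  ... | kept x′ | punched | kept _  rewrite pinch-kept x′ = kept<kept⇒≢ xz

  -- The low letters `a` and `c` stay away from `j`, and every comparison in a crossing involves one
  -- of them, so all remain strict.
  crossing-pinch : Crossing σ → Crossing π
  crossing-pinch X = record
    { a<b   = pinch-< (inj₁ a≢j) a<b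
    ; b<c   = pinch-< (inj₂ c≢j) b<c
    ; c<d   = pinch-< (inj₁ c≢j) c<d
    ; σa<σb = pinch-val a≢j σa<σb
    ; σa<σd = pinch-val a≢j σa<σd
    ; σc<σb = pinch-val c≢j σc<σb
    ; σc<σd = pinch-val c≢j σc<σd
    }
    where
    open Crossing X
    a≢j = low⇒pinch≢ b≢d σa<σb σa<σd
    c≢j = low⇒pinch≢ b≢d σc<σb σc<σd

pinch-suc : ∀ (j : Fin n) → pinch j (suc j) ≡ j
pinch-suc zero    = refl
pinch-suc (suc j) = cong suc (pinch-suc j)

pinch-inject₁ : ∀ (j : Fin n) → pinch j (inject₁ j) ≡ j
pinch-inject₁ zero    = refl
pinch-inject₁ (suc j) = cong suc (pinch-inject₁ j)

pinch-punchIn-suc : ∀ (j x : Fin n) → pinch j (punchIn (suc j) x) ≡ x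
pinch-punchIn-suc zero    zero    = refl
pinch-punchIn-suc zero    (suc x) = refl
pinch-punchIn-suc (suc j) zero    = refl
pinch-punchIn-suc (suc j) (suc x) = cong suc (pinch-punchIn-suc j x)

pinch-punchIn-inject₁ : ∀ (j x : Fin n) → pinch j (punchIn (inject₁ j) x) ≡ x
pinch-punchIn-inject₁ zero    x       = refl
pinch-punchIn-inject₁ (suc j) zero    = refl
pinch-punchIn-inject₁ (suc j) (suc x) = cong suc (pinch-punchIn-inject₁ j x)

module _ (j : Fin (suc n)) (ρ : Permutation′ n) where

  -- Position `suc j` is directly right of the previous maximum; position `inject₁ j` is directly
  -- left of it and pushes it to `suc j`.
  crossing-right : Crossing (insertMax (suc j) (insertMax j ρ)) → Crossing (insertMax j ρ)
  crossing-right = crossing-pinch (insertMax j ρ) (insertMax-> j ρ) (pinch-suc j) (pinch-punchIn-suc j)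

  crossing-left : Crossing (insertMax (inject₁ j) (insertMax j ρ)) → Crossing (insertMax j ρ)
  crossing-left = crossing-pinch (insertMax j ρ) (insertMax-> j ρ)
    (pinch-inject₁ j) (pinch-punchIn-inject₁ j)

-- Placements of the maximum that force a crossing.

punchIn-after : ∀ (i : Fin (suc n)) x → toℕ i ℕ.≤ toℕ x → i < punchIn i x
punchIn-after zero    x       _           = z<s
punchIn-after (suc i) (suc x) (ℕ.s≤s i≤x) = s<s (punchIn-after i x i≤x)

punchIn-before : ∀ (i : Fin (suc n)) x → toℕ x ℕ.< toℕ i → punchIn i x < i
punchIn-before (suc i) zero    _         = z<s
punchIn-before (suc i) (suc x) (s<s x<i) = s<s (punchIn-before i x x<i)

module _ (i : Fin (suc n)) (j : Fin n) (ρ : Permutation′ n) where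
  private
    π = insertMax (suc j) ρ
    σ = insertMax (suc i) π

    <max : ∀ {x} → σ ⟨$⟩ʳ punchIn (suc i) x < σ ⟨$⟩ʳ suc i
    <max = insertMax-> (suc i) π (punchInᵢ≢i (suc i) _)

    <second : ∀ {x} → x ≢ suc j → σ ⟨$⟩ʳ punchIn (suc i) x < σ ⟨$⟩ʳ punchIn (suc i) (suc j)
    <second x≢j = insertMax-mono (suc i) π (insertMax-> (suc j) ρ x≢j)

  -- Here `b` is the maximum and `d` the previous one; `c` is the letter just before `d` and still
  -- after `b`. As neither maximum leads, position 0 serves as `a`.
  crossing-maxBefore : i < inject₁ j → Crossing σ
  crossing-maxBefore i<j = record
    { a     = 0F
    ; c     = punchIn (suc i) (inject₁ j)
    ; a<b   = z<s
    ; b<c   = punchIn-after (suc i) (inject₁ j) i<j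
    ; c<d   = punchIn-mono-< (suc i) {inject₁ j} j<1+j
    ; σa<σb = <max {0F}
    ; σa<σd = <second {0F} λ ()
    ; σc<σb = <max
    ; σc<σd = <second (<⇒≢ j<1+j)
    }
    where
    j<1+j : inject₁ j < suc j
    j<1+j = s<s (ℕ.≤-reflexive (toℕ-inject₁ j))

  -- The roles swap: `b` is the previous maximum, `d` the maximum, and `c` the letter just before
  -- `d`.
  crossing-maxAfter : suc j < i → Crossing σ
  crossing-maxAfter j<i = record
    { a     = 0F
    ; c     = punchIn (suc i) i
    ; a<b   = z<s
    ; b<c   = punchIn-mono-< (suc i) j<i
    ; c<d   = punchIn-before (suc i) i (ℕ.n<1+n _)
    ; σa<σb = <second {0F} λ ()
    ; σa<σd = <max {0F}
    ; σc<σb = <second (<⇒≢ j<i ∘ sym)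
    ; σc<σd = <max
    }

-- Codes for crossing-free permutations.

mutual
  data Code : ℕ → Set where
    empty : Code 0
    first : Code n → Code (suc n)
    later : Later n → Code (suc n)

  -- Permutations of length n + 1 whose maximum is not in front, classified by the
  -- position of the previous maximum relative to the maximum: both leading, in
  -- front of everything, or adjacent on the left or on the right.
  data Later : ℕ → Set where
    both              : Code n → Later (suc n)
    front left right  : Later n → Later (suc n)

mutual
  decode : Code n → Permutation′ n
  decode empty     = id
  decode (first c) = insertMax 0F (decode c)
  decode (later w) = insertMax (suc (position w)) (rest w)

  -- One less than the place of the maximum, so that the maximum is never in front.
  position : Later n → Fin n
  position (both c)  = 0F
  position (front w) = suc (position w)
  position (left w)  = suc (position w)
  position (right w) = inject₁ (position w)

  -- What remains once the maximum is deleted. For `left` and `right` this is the permutation coded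
  -- by `w` itself; for `front` that one appears when the previous maximum is deleted instead.
  rest : Later n → Permutation′ n
  rest (both c)  = insertMax 0F (decode c)
  rest (front w) = insertMax 0F (rest w)
  rest (left w)  = insertMax (suc (position w)) (rest w)
  rest (right w) = insertMax (suc (position w)) (rest w)

mutual
  decode-sound : (c : Code n) → ¬ Crossing (decode c)
  decode-sound empty record { a = () }
  decode-sound (first c) = decode-sound c ∘ crossing-maxFront (decode c)
  decode-sound (later w) = later-sound w

  later-sound : (w : Later n) → ¬ Crossing (insertMax (suc (position w)) (rest w))
  later-sound (both c)  = decode-sound c ∘ crossing-maxFront (decode c)
                          ∘ crossing-frontSecond 0F (decode c)
  later-sound (front w) = later-sound w ∘ crossing-frontSecond (suc (position w)) (rest w)
  -- A previous maximum on the left means that the maximum was inserted on its right, and conversely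
  -- for `right`.
  later-sound (left w)  = later-sound w ∘ crossing-right (suc (position w)) (rest w)
  later-sound (right w) = later-sound w ∘ crossing-left (suc (position w)) (rest w)

suc≢inject₁ : {i : Fin n} → suc i ≢ inject₁ i
suc≢inject₁ {i = i} eq = ℕ.1+n≢n (trans (cong toℕ eq) (toℕ-inject₁ i))

mutual
  decode-injective : (c c′ : Code n) → decode c ≈ₚ decode c′ → c ≡ c′
  decode-injective empty     empty      eq = refl
  decode-injective (first c) (first c′) eq =
    cong first (decode-injective c c′ (proj₂ (insertMax-injective eq)))
  decode-injective (first c) (later w)  eq with () ← proj₁ (insertMax-injective eq)
  decode-injective (later w) (first c)  eq with () ← proj₁ (insertMax-injective eq)
  decode-injective (later w) (later w′) eq with p , q ← insertMax-injective eq =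
    cong later (later-injective w w′ (suc-injective p) q)

  -- `rest` shows where the previous maximum is, which separates `both` and `front` from `left` and
  -- `right`; within each pair `position` decides.
  later-injective : (w w′ : Later n) → position w ≡ position w′ → rest w ≈ₚ rest w′ → w ≡ w′
  later-injective (both c) (both c′) _ q =
    cong both (decode-injective c c′ (proj₂ (insertMax-injective q)))
  later-injective (front w) (front w′) p q =
    cong front (later-injective w w′ (suc-injective p) (proj₂ (insertMax-injective q)))
  later-injective (left w) (left w′) p q =
    cong left (later-injective w w′ (suc-injective p) (proj₂ (insertMax-injective q)))
  later-injective (right w) (right w′) p q =
    cong right (later-injective w w′ (inject₁-injective p) (proj₂ (insertMax-injective q)))
  later-injective (left w) (right w′) p q = contradiction
    (trans (sym (proj₁ (insertMax-injective q))) p) suc≢inject₁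
  later-injective (right w) (left w′) p q = contradiction
    (trans (proj₁ (insertMax-injective q)) (sym p)) suc≢inject₁
  later-injective (both _)  (front _) () _
  later-injective (both _)  (left _)  () _
  later-injective (front _) (both _)  () _
  later-injective (left _)  (both _)  () _
  later-injective (both _)  (right _) _  q with () ← proj₁ (insertMax-injective q)
  later-injective (right _) (both _)  _  q with () ← proj₁ (insertMax-injective q)
  later-injective (front _) (left _)  _  q with () ← proj₁ (insertMax-injective q)
  later-injective (front _) (right _) _  q with () ← proj₁ (insertMax-injective q)
  later-injective (left _)  (front _) _  q with () ← proj₁ (insertMax-injective q)
  later-injective (right _) (front _) _  q with () ← proj₁ (insertMax-injective q)

mutual
  decode-complete : (σ : Permutation′ n) → ¬ Crossing σ → ∃[ c ] decode c ≈ₚ σ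
  decode-complete {zero}  σ ok = empty , λ ()
  decode-complete {suc n} σ ok with insertMax-surjective σ
  ... | zero  , π , eq with c , e ← decode-complete π (ok ∘ crossing-resp eq ∘ crossing-insertMax 0F π) =
    first c , λ x → trans (insertMax-cong 0F e x) (eq x)
  ... | suc i , π , eq with w , refl , e ← later-complete i π (ok ∘ crossing-resp eq) =
    later w , λ x → trans (insertMax-cong (suc i) e x) (eq x)

  later-complete : (i : Fin n) (π : Permutation′ n) → ¬ Crossing (insertMax (suc i) π) →
                   ∃[ w ] position w ≡ i × rest w ≈ₚ π
  later-complete {suc n} i π ok with insertMax-surjective π
  later-complete {suc n} zero π ok | zero , ρ , eq
    with c , e ← decode-complete ρ
           (ok ∘ crossing-insertMax 1F π ∘ crossing-resp eq ∘ crossing-insertMax 0F ρ) =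
    both c , refl , λ x → trans (insertMax-cong 0F e x) (eq x)
  -- The leading previous maximum is deleted rather than the maximum; a crossing of what is left
  -- would survive putting it back.
  later-complete {suc n} (suc i) π ok | zero , ρ , eq
    with w , refl , e ← later-complete i ρ
           (ok ∘ crossing-resp (insertMax-cong (suc (suc i)) eq) ∘ crossing-frontSecond⁻ (suc i) ρ) =
    front w , refl , λ x → trans (insertMax-cong 0F e x) (eq x)
  later-complete {suc n} i π ok | suc j , ρ , eq
    with w , refl , e ← later-complete j ρ (ok ∘ crossing-insertMax (suc i) π ∘ crossing-resp eq)
    with <-cmp i (inject₁ j) | <-cmp (suc j) i
  ... | tri< i<j _ _ | _ = contradiction
    (crossing-resp (insertMax-cong (suc i) eq) (crossing-maxBefore i j ρ i<j)) ok
  ... | _ | tri< j<i _ _ = contradiction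
    (crossing-resp (insertMax-cong (suc i) eq) (crossing-maxAfter i j ρ j<i)) ok
  ... | tri≈ _ i≡j _ | _ = right w , sym i≡j , λ x → trans (insertMax-cong (suc j) e x) (eq x)
  ... | _ | tri≈ _ j≡i _ = left w , j≡i , λ x → trans (insertMax-cong (suc j) e x) (eq x)
  -- No position lies strictly between `inject₁ j` and `suc j`.
  ... | tri> _ _ j<i | tri> _ _ i<1+j = contradiction
    (ℕ.≤-trans i<1+j (ℕ.≤-trans (s<s (ℕ.≤-reflexive (sym (toℕ-inject₁ j)))) j<i)) (ℕ.<-irrefl refl)

-- Counting codes.

mutual
  codes laters : ℕ → ℕ
  codes zero    = 1
  codes (suc n) = codes n ℕ.+ laters n
  laters zero    = 0
  laters (suc n) = codes n ℕ.+ 3 ℕ.* laters n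

mutual
  code↔ : ∀ n → Code n ↔ Fin (codes n)
  code↔ zero    = mk↔ₛ′ (λ _ → 0F) (λ _ → empty) (λ { zero → refl ; (suc ()) }) (λ { empty → refl })
  code↔ (suc n) = ↔-sym +↔⊎ ↔-∘ ((code↔ n ⊎-cong later↔ n) ↔-∘ cases)
    where
    cases : Code (suc n) ↔ (Code n ⊎ Later n)
    cases = mk↔ₛ′ (λ { (first c) → inj₁ c ; (later w) → inj₂ w })
                  (λ { (inj₁ c) → first c ; (inj₂ w) → later w })
                  (λ { (inj₁ _) → refl ; (inj₂ _) → refl })
                  (λ { (first _) → refl ; (later _) → refl })

  later↔ : ∀ n → Later n ↔ Fin (laters n)
  later↔ zero    = mk↔ₛ′ (λ ()) (λ ()) (λ ()) (λ ())
  later↔ (suc n) =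
    ↔-sym +↔⊎ ↔-∘ ((code↔ n ⊎-cong (↔-sym *↔× ↔-∘ (↔-id (Fin 3) ×-cong later↔ n))) ↔-∘ cases)
    where
    cases : Later (suc n) ↔ (Code n ⊎ (Fin 3 × Later n))
    cases = mk↔ₛ′
      (λ { (both c) → inj₁ c ; (front w) → inj₂ (0F , w)
         ; (left w) → inj₂ (1F , w) ; (right w) → inj₂ (2F , w) })
      (λ { (inj₁ c) → both c ; (inj₂ (0F , w)) → front w
         ; (inj₂ (1F , w)) → left w ; (inj₂ (2F , w)) → right w })
      (λ { (inj₁ _) → refl ; (inj₂ (0F , _)) → refl
         ; (inj₂ (1F , _)) → refl ; (inj₂ (2F , _)) → refl })
      (λ { (both _) → refl ; (front _) → refl ; (left _) → refl ; (right _) → refl })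

-- Two unfoldings express everything by x = `codes n` and y = `laters n`, and (x + y) + (x + 3y) =
-- 4(x + y) - 2x.
codes-recurrence : ∀ n → + codes (2 ℕ.+ n) ≡ + 4 * + codes (1 ℕ.+ n) - + 2 * + codes n
codes-recurrence n = trans
  (cong (λ k → + codes n + + laters n + (+ codes n + k)) (ℤ.pos-* 3 (laters n)))
  (identity (+ codes n) (+ laters n))
  where
  identity : ∀ x y → x + y + (x + + 3 * y) ≡ + 4 * (x + y) - + 2 * x
  identity = solve-∀

-- Crossings and occurrences of the patterns.

chain-mono : (f : Fin (suc m) → Fin n) → (∀ j → f (inject₁ j) < f (suc j)) →
             ∀ s t → s < t → f s < f t
chain-mono {m = suc _} f step zero    (suc zero)    _        = step 0F
chain-mono {m = suc _} f step zero    (suc (suc t)) _        =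
  ℕ.<-trans (step 0F) (chain-mono (f ∘ suc) (step ∘ suc) 0F (suc t) z<s)
chain-mono {m = suc _} f step (suc s) (suc t)       (s<s lt) =
  chain-mono (f ∘ suc) (step ∘ suc) s t lt

-- Neighbouring comparisons suffice: once along positions, and once along the letters sorted by
-- value, which the inverse of `letters` lists. Trichotomy gives the converse half of `sameOrder`.
occurrence : ∀ (p : Pattern) (σ : Permutation′ n) (i : Vec (Fin n) (suc (Pattern.gapCount p))) →
  let open Pattern p in
  (∀ j → lookup i (inject₁ j) < lookup i (suc j)) →
  (∀ j → σ ⟨$⟩ʳ lookup i (letters ⟨$⟩ˡ inject₁ j) < σ ⟨$⟩ʳ lookup i (letters ⟨$⟩ˡ suc j)) →
  (∀ j → lookup gaps j ≡ adjacent → toℕ (lookup i (suc j)) ≡ suc (toℕ (lookup i (inject₁ j)))) →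
  IsOccurrence p σ i
occurrence p σ i inc val con = record
  { increasing = chain-mono (lookup i) inc
  ; sameOrder  = λ s t → mk⇔ (reflects s t) mono
  ; contiguous = con
  }
  where
  open Pattern p

  mono : ∀ {s t} → letters ⟨$⟩ʳ s < letters ⟨$⟩ʳ t → σ ⟨$⟩ʳ lookup i s < σ ⟨$⟩ʳ lookup i t
  mono lt = subst₂ (λ s t → σ ⟨$⟩ʳ lookup i s < σ ⟨$⟩ʳ lookup i t) (inverseˡ letters) (inverseˡ letters)
    (chain-mono (λ q → σ ⟨$⟩ʳ lookup i (letters ⟨$⟩ˡ q)) val _ _ lt)

  reflects : ∀ s t → σ ⟨$⟩ʳ lookup i s < σ ⟨$⟩ʳ lookup i t → letters ⟨$⟩ʳ s < letters ⟨$⟩ʳ t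
  reflects s t lt with <-cmp (letters ⟨$⟩ʳ s) (letters ⟨$⟩ʳ t)
  ... | tri< s<t _ _ = s<t
  ... | tri≈ _ s≡t _ = contradiction (cong (λ s → σ ⟨$⟩ʳ lookup i s) (⟨$⟩ʳ-injective letters s≡t)) (<⇒≢ lt)
  ... | tri> _ _ t<s = contradiction (mono t<s) (ℕ.<-asym lt)

-- `A` and `B` are the instances at `x-xx-x` and `x-x-x-x`, so one argument covers both.
patterns : Vec Gap 3 → List Pattern
patterns g = (⟨1324⟩ separatedBy g) ∷ (⟨1423⟩ separatedBy g)
           ∷ (⟨2314⟩ separatedBy g) ∷ (⟨2413⟩ separatedBy g) ∷ []

module _ {σ : Permutation′ n} {g : Vec Gap 3} where

  crossing⇒¬avoids : (X : Crossing σ) → let open Crossing X ; i = a ∷ b ∷ c ∷ d ∷ [] in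
    (∀ j → lookup g j ≡ adjacent → toℕ (lookup i (suc j)) ≡ suc (toℕ (lookup i (inject₁ j)))) →
    ¬ Avoids σ (patterns g)
  crossing⇒¬avoids X con (¬1324 ∷ ¬1423 ∷ ¬2314 ∷ ¬2413 ∷ []) =
    compare (<-cmp (σ ⟨$⟩ʳ a) (σ ⟨$⟩ʳ c)) (<-cmp (σ ⟨$⟩ʳ b) (σ ⟨$⟩ʳ d))
    where
    open Crossing X

    contains : ∀ π → let q = π separatedBy g ; i = a ∷ b ∷ c ∷ d ∷ [] in
      (∀ j → σ ⟨$⟩ʳ lookup i (π ⟨$⟩ˡ inject₁ j) < σ ⟨$⟩ʳ lookup i (π ⟨$⟩ˡ suc j)) → Contains σ q
    contains π val = a ∷ b ∷ c ∷ d ∷ [] , occurrence (π separatedBy g) σ _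
      (λ { 0F → a<b ; 1F → b<c ; 2F → c<d }) val con

    compare : Tri _ _ _ → Tri _ _ _ → ⊥
    -- Each case supplies the chain of values in increasing order, here that of `a`, `c`, `b`, `d`.
    compare (tri< ac _ _) (tri< bd _ _) = ¬1324 (contains ⟨1324⟩ λ { 0F → ac ; 1F → σc<σb ; 2F → bd })
    compare (tri< ac _ _) (tri> _ _ db) = ¬1423 (contains ⟨1423⟩ λ { 0F → ac ; 1F → σc<σd ; 2F → db })
    compare (tri> _ _ ca) (tri< bd _ _) = ¬2314 (contains ⟨2314⟩ λ { 0F → ca ; 1F → σa<σb ; 2F → bd })
    compare (tri> _ _ ca) (tri> _ _ db) = ¬2413 (contains ⟨2413⟩ λ { 0F → ca ; 1F → σa<σd ; 2F → db })
    compare (tri≈ _ ac _) _             = <⇒≢ (ℕ.<-trans a<b b<c) (⟨$⟩ʳ-injective σ ac)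
    compare _             (tri≈ _ bd _) = b≢d (⟨$⟩ʳ-injective σ bd)

  contains⇒crossing : ∀ (π : Permutation′ 4) →
    π ⟨$⟩ʳ 0F < π ⟨$⟩ʳ 1F → π ⟨$⟩ʳ 0F < π ⟨$⟩ʳ 3F →
    π ⟨$⟩ʳ 2F < π ⟨$⟩ʳ 1F → π ⟨$⟩ʳ 2F < π ⟨$⟩ʳ 3F →
    Contains σ (π separatedBy g) → Crossing σ
  contains⇒crossing π 0<1 0<3 2<1 2<3 (_ , o) = record
    { a<b   = increasing 0F 1F z<s
    ; b<c   = increasing 1F 2F (s<s z<s)
    ; c<d   = increasing 2F 3F (s<s (s<s z<s))
    ; σa<σb = Equivalence.from (sameOrder 0F 1F) 0<1
    ; σa<σd = Equivalence.from (sameOrder 0F 3F) 0<3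
    ; σc<σb = Equivalence.from (sameOrder 2F 1F) 2<1
    ; σc<σd = Equivalence.from (sameOrder 2F 3F) 2<3
    }
    where open IsOccurrence o

  ¬crossing⇒avoids : ¬ Crossing σ → Avoids σ (patterns g)
  ¬crossing⇒avoids ¬X =
      (¬X ∘ contains⇒crossing ⟨1324⟩ z<s z<s (s<s z<s) (s<s z<s))
    ∷ (¬X ∘ contains⇒crossing ⟨1423⟩ z<s z<s (s<s z<s) (s<s z<s))
    ∷ (¬X ∘ contains⇒crossing ⟨2314⟩ (s<s z<s) (s<s z<s) z<s z<s)
    ∷ (¬X ∘ contains⇒crossing ⟨2413⟩ (s<s z<s) (s<s z<s) z<s z<s)
    ∷ []

-- Making the two middle letters adjacent.

-- Induction on the number `k` of positions between `b` and `c`. If the right neighbour `e` of `b`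
-- exceeds both low letters, it replaces `b`; otherwise it is below both high letters and replaces
-- `c`.
tighten : ∀ {σ : Permutation′ n} k (X : Crossing σ) → let open Crossing X in
          toℕ c ≡ suc (k ℕ.+ toℕ b) →
          ∃[ Y ] toℕ (Crossing.c {σ = σ} Y) ≡ suc (toℕ (Crossing.b Y))
tighten zero X eq = X , eq
tighten {n} {σ} (suc k) X eq = split (σ ⟨$⟩ʳ a <? σ ⟨$⟩ʳ e) (σ ⟨$⟩ʳ c <? σ ⟨$⟩ʳ e)
  where
  open Crossing X

  e : Fin n
  e = fromℕ< (ℕ.≤-<-trans b<c (toℕ<n c))

  toℕ-e : toℕ e ≡ suc (toℕ b)
  toℕ-e = toℕ-fromℕ< _

  b<e : b < e
  b<e = ℕ.≤-reflexive (sym toℕ-e)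

  e<c : e < c
  e<c = subst₂ ℕ._<_ (sym toℕ-e) (sym eq) (s<s (s<s (ℕ.m≤n+m (toℕ b) k)))

  low : σ ⟨$⟩ʳ e < σ ⟨$⟩ʳ b → σ ⟨$⟩ʳ e < σ ⟨$⟩ʳ d →
        ∃[ Y ] toℕ (Crossing.c {σ = σ} Y) ≡ suc (toℕ (Crossing.b Y))
  low eb ed = record { a<b = a<b ; b<c = b<e ; c<d = ℕ.<-trans e<c c<d
                     ; σa<σb = σa<σb ; σa<σd = σa<σd ; σc<σb = eb ; σc<σd = ed } , toℕ-e

  split : Dec (σ ⟨$⟩ʳ a < σ ⟨$⟩ʳ e) → Dec (σ ⟨$⟩ʳ c < σ ⟨$⟩ʳ e) →
          ∃[ Y ] toℕ (Crossing.c {σ = σ} Y) ≡ suc (toℕ (Crossing.b Y))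
  split (yes ae) (yes ce) = tighten k
    (record { a<b = ℕ.<-trans a<b b<e ; b<c = e<c ; c<d = c<d
            ; σa<σb = ae ; σa<σd = σa<σd ; σc<σb = ce ; σc<σd = σc<σd })
    (trans eq (cong suc (trans (sym (ℕ.+-suc k (toℕ b))) (cong (k ℕ.+_) (sym toℕ-e)))))
  split (no ae) _ = low (ℕ.≤-<-trans (ℕ.≮⇒≥ ae) σa<σb) (ℕ.≤-<-trans (ℕ.≮⇒≥ ae) σa<σd)
  split _ (no ce) = low (ℕ.≤-<-trans (ℕ.≮⇒≥ ce) σc<σb) (ℕ.≤-<-trans (ℕ.≮⇒≥ ce) σc<σd)

avoidsB⇒¬crossing : {σ : Permutation′ n} → Avoids σ B → ¬ Crossing σ
-- With dashes everywhere, contiguity is vacuous.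
avoidsB⇒¬crossing av X = crossing⇒¬avoids {g = x-x-x-x} X (λ { 0F () ; 1F () ; 2F () }) av

avoidsA⇒¬crossing : {σ : Permutation′ n} → Avoids σ A → ¬ Crossing σ
avoidsA⇒¬crossing av X with ℕ.m≤n⇒∃[o]m+o≡n (Crossing.b<c X)
... | k , b+k≡c with tighten k X (trans (sym b+k≡c) (cong suc (ℕ.+-comm _ k)))
...   | Y , adj = crossing⇒¬avoids {g = x-xx-x} Y (λ { 0F () ; 1F _ → adj ; 2F () }) av

-- Transfer of the count to avoiders.

module _ {S : List Pattern}
         (avoids⇒¬crossing : ∀ {n} {σ : Permutation′ n} → Avoids σ S → ¬ Crossing σ)
         (¬crossing⇒avoids : ∀ {n} {σ : Permutation′ n} → ¬ Crossing σ → Avoids σ S) where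

  decoding : ∀ n → Bijection (setoid (Code n)) (Av n S)
  decoding n = record
    { to        = λ c → decode c , ¬crossing⇒avoids (decode-sound c)
    ; cong      = λ { refl _ → refl }
    ; bijective = (λ {c} {c′} → decode-injective c c′)
                , (λ (σ , av) → let c , eq = decode-complete σ (avoids⇒¬crossing av)
                                in c , λ { refl → eq })
    }

  -- The enumeration of avoiders, the decoding and the count of codes compose to a bijection between
  -- two `Fin` types, whose sizes must then agree.
  ∣Av∣≡codes : ∀ n → ∣Av∣ n S ≡ codes n
  ∣Av∣≡codes n = ↔⇒≡ (Composition.inverse (Bijection⇒Inverse (Finite.enumeration (av-finite n S)))
    (Composition.inverse (Symmetry.inverse (Bijection⇒Inverse (decoding n))) (code↔ n)))

  ∣Av∣-recurrence : ∀ n → n ≥ 3 →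
    + (∣Av∣ n S) ≡ + 4 * + (∣Av∣ (n ∸ 1) S) - + 2 * + (∣Av∣ (n ∸ 2) S)
  ∣Av∣-recurrence (suc zero)    (ℕ.s≤s ())
  ∣Av∣-recurrence (suc (suc n)) _ = trans (cong +_ (∣Av∣≡codes (2 ℕ.+ n)))
    (trans (codes-recurrence n)
      (sym (cong₂ (λ x y → + 4 * + x - + 2 * + y) (∣Av∣≡codes (1 ℕ.+ n)) (∣Av∣≡codes n))))

proposition2 : ( ∣Av∣ 1 B ≡ 1
    × ∣Av∣ 2 B ≡ 2
    × ((n : ℕ) → n ≥ 3 → + (∣Av∣ n B) ≡ + 4 * + (∣Av∣ (n ∸ 1) B) - + 2 * + (∣Av∣ (n ∸ 2) B)) )
    ×
    ( ∣Av∣ 1 A ≡ 1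
    × ∣Av∣ 2 A ≡ 2
    × ((n : ℕ) → n ≥ 3 → + (∣Av∣ n A) ≡ + 4 * + (∣Av∣ (n ∸ 1) A) - + 2 * + (∣Av∣ (n ∸ 2) A)) )
proposition2 =
    ( ∣Av∣≡codes avoidsB⇒¬crossing ¬crossing⇒avoids 1
    , ∣Av∣≡codes avoidsB⇒¬crossing ¬crossing⇒avoids 2
    , ∣Av∣-recurrence avoidsB⇒¬crossing ¬crossing⇒avoids )
  , ( ∣Av∣≡codes avoidsA⇒¬crossing ¬crossing⇒avoids 1
    , ∣Av∣≡codes avoidsA⇒¬crossing ¬crossing⇒avoids 2
    , ∣Av∣-recurrence avoidsA⇒¬crossing ¬crossing⇒avoids )
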